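{- For every closed $\mathrm{ACP}^{\tau}_{\mathrm{drt}}\mathrm{REC}$ term $t$ in which no abstraction operator $\tau_I$ occurs, there exists a closed $\mathrm{ACP}^{\tau}_{\mathrm{drt}}\mathrm{REC}$ term $t'$ that is a closed term of $\mathrm{BPA}^{\tau}_{\mathrm{drt}}\mathrm{REC}$ such that $t=t'$ is derivable from the axioms of $\mathrm{ACP}^{\tau}_{\mathrm{drt}}\mathrm{REC}$.
   Context: Fix a finite set $A$ of basic actions with $\tau,\delta\notin A$, and a commutative and associative function $\gamma:(A\cup\{\tau,\delta\})^2\to A\cup\{\tau,\delta\}$ with $\gamma(\tau,a)=\gamma(\delta,a)=\delta$ for all $a$. The signature of $\mathrm{ACP}^{\tau}_{\mathrm{drt}}$ consists of the constants $\underline{a}$ ($a\in A$), $\underline{\tau}$, $\underline{\delta}$; the binary operators $+$, $\cdot$, $\parallel$, $\lfloor\!\lfloor$ (left merge), $\mid$ (communication merge); and the unary operators $\sigma$ (one-time-slice delay), $\partial_H$ for $H\subseteq A$, $\tau_I$ for $I\subseteq A$ (abstraction), and $\nu$ (time-out). The signature of $\mathrm{BPA}^{\tau}_{\mathrm{drt}}$ is obtained by omitting $\parallel,\lfloor\!\lfloor,\mid,\partial_H$. The axioms of $\mathrm{ACP}^{\tau}_{\mathrm{drt}}$ are ($a,b,c$ range over $A\cup\{\tau,\delta\}$, $H,I\subseteq A$): $x+y=y+x$; $(x+y)+z=x+(y+z)$; $x+x=x$; $(x+y)\cdot z=x\cdot z+y\cdot z$; $(x\cdot y)\cdot z=x\cdot(y\cdot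 z)$; $x+\underline{\delta}=x$; $\underline{\delta}\cdot x=\underline{\delta}$; $\sigma(x)+\sigma(y)=\sigma(x+y)$; $\sigma(x)\cdot y=\sigma(x\cdot y)$; $\partial_H(\underline a)=\underline a$ if $a\notin H$; $\partial_H(\underline a)=\underline\delta$ if $a\in H$; $\partial_H(x+y)=\partial_H(x)+\partial_H(y)$; $\partial_H(x\cdot y)=\partial_H(x)\cdot\partial_H(y)$; $\partial_H(\sigma(x))=\sigma(\partial_H(x))$; $\tau_I(\underline a)=\underline a$ if $a\notin I$; $\tau_I(\underline a)=\underline\tau$ if $a\in I$; $\tau_I(x+y)=\tau_I(x)+\tau_I(y)$; $\tau_I(x\cdot y)=\tau_I(x)\cdot\tau_I(y)$; $\tau_I(\sigma(x))=\sigma(\tau_I(x))$; $x\parallel y=(x\lfloor\!\lfloor y+y\lfloor\!\lfloor x)+x\mid y$; $\underline a\lfloor\!\lfloor x=\underline a\cdot x$; $\underline a\cdot x\lfloor\!\lfloor y=\underline a\cdot(x\parallel y)$; $\sigma(x)\lfloor\!\lfloor\nu(y)=\underline\delta$; $\sigma(x)\lfloor\!\lfloor(\nu(y)+\sigma(z))=\sigma(x\lfloor\!\lfloor z)$; $(x+y)\lfloor\!\lfloor z=x\lfloor\!\lfloor z+y\lfloor\!\lfloor z$; $\underline a\cdot x\mid\underline b=(\underline a\mid\underline b)\cdot x$; $\underline a\mid\underline b\cdot x=(\underline a\mid\underline b)\cdot x$; $\underline a\cdot x\mid\underline b\cdot y=(\underline a\mid\underline b)\cdot(x\parallel y)$;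 $\nu(x)\mid\sigma(y)=\underline\delta$; $\sigma(x)\mid\nu(y)=\underline\delta$; $\sigma(x)\mid\sigma(y)=\sigma(x\mid y)$; $(x+y)\mid z=x\mid z+y\mid z$; $x\mid(y+z)=x\mid y+x\mid z$; $\underline a\mid\underline b=\underline c$ if $\gamma(a,b)=c$; $\nu(\underline a)=\underline a$; $\nu(x+y)=\nu(x)+\nu(y)$; $\nu(x\cdot y)=\nu(x)\cdot y$; $\nu(\sigma(x))=\underline\delta$; $\underline a\cdot\underline\tau=\underline a$; $\underline a\cdot(\underline\tau\cdot(\nu(x)+y)+\nu(x))=\underline a\cdot(\nu(x)+y)$; $\underline a\cdot(\underline\tau\cdot(\nu(x)+y)+y)=\underline a\cdot(\nu(x)+y)$; $\underline a\cdot(\sigma(\underline\tau\cdot x)+\nu(y))=\underline a\cdot(\sigma(x)+\nu(y))$. The axioms of $\mathrm{BPA}^{\tau}_{\mathrm{drt}}$ are those not mentioning $\parallel,\lfloor\!\lfloor,\mid,\partial_H$. Recursion. An occurrence of a variable $X$ in a term $t$ over a signature $\Sigma$ including that of $\mathrm{BPA}^{\tau}_{\mathrm{drt}}$ is guarded if no abstraction operator occurs in $t$ and $t$ has a subterm $\underline a\cdot t'$ ($a\in A$) or $\sigma(t')$ with $t'$ containing the occurrence; $t$ is guarded if all its variable occurrences are. A recursive specification over $\Sigma$ is a set $E=\{X_i=t_i\mid i\in I\}$ with distinct variables $X_i$ and terms $t_i$ over $\Sigma$ with variables in $\mathrm{vars}(E)=\{X_i\}$; for an equation set $\Phi$ containing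 the $\mathrm{BPA}^{\tau}_{\mathrm{drt}}$ axioms, $E$ is guarded modulo $\Phi$ if each $t_i$ can be rewritten to a guarded term using $\Phi$ in either direction and/or $X_j=t_j$ ($j\ne i$) left to right. For $T\in\{\mathrm{ACP}^{\tau}_{\mathrm{drt}},\mathrm{BPA}^{\tau}_{\mathrm{drt}}\}$, the signature/axioms of $T\mathrm{REC}$ are $\bigcup_i\Sigma_i$/$\bigcup_i\Phi_i$, where $\Sigma_0,\Phi_0$ are those of $T$ and $\Sigma_{i+1}$ ($\Phi_{i+1}$) adds, for each $E$ over $\Sigma_i$ guarded modulo $\Phi_i$ and $X\in\mathrm{vars}(E)$, a recursion constant $\langle X\mid E\rangle$ (resp. the equation $\langle X\mid E\rangle=\langle t\mid E\rangle$ for $X=t\in E$, and the conditional equation $E\Rightarrow X=\langle X\mid E\rangle$); $\langle t\mid E\rangle$ is $t$ with each $Y\in\mathrm{vars}(E)$ replaced by $\langle Y\mid E\rangle$. Derivations use conditional equational logic. -}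

module Defs where

open import Data.Nat using (ℕ; zero; suc)
open import Data.Fin using (Fin)
open import Data.Fin.Subset using (Subset; _∈_)
open import Data.Maybe using (Maybe; just; nothing)
open import Data.Bool using (Bool; true; false)
open import Data.Empty using (⊥)
open import Data.Unit using (⊤)
open import Data.Product using (Σ; ∃; _×_; _,_)
open import Data.Sum using (_⊎_)
open import Relation.Nullary using (¬_)
open import Relation.Binary.PropositionalEquality using (_≡_; _≢_)

data Act (n : ℕ) : Set where
  act   : Fin n → Act n
  tau   : Act n
  delta : Act n

_∈ₐ_ : ∀ {n} → Act n → Subset n → Set
act a ∈ₐ H = a ∈ H
tau   ∈ₐ H = ⊥
delta ∈ₐ H = ⊥

-- Raw terms over the full signature of ACP^τ_drt REC, with variables
-- (indexed by ℕ) and recursion constants ⟨X | E⟩.  A recursive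
-- specification E is a map from variables to Maybe right-hand sides:
-- vars(E) = { X | E X ≡ just _ }, and E contains the equation X = t
-- iff E X ≡ just t.  Specifications may be infinite.

infixl 6 _⊕_
infixl 7 _⊙_

data Term (n : ℕ) : Set where
  v     : ℕ → Term n
  at    : Act n → Term n
  _⊕_   : Term n → Term n → Term n
  _⊙_   : Term n → Term n → Term n
  _‖_   : Term n → Term n → Term n
  _⌊⌊_  : Term n → Term n → Term n
  _∣ᶜ_  : Term n → Term n → Term n
  σ     : Term n → Term n
  ∂[_]  : Subset n → Term n → Term n
  τ[_]  : Subset n → Term n → Term n
  ν     : Term n → Term n
  rec   : (ℕ → Maybe (Term n)) → ℕ → Term n

Spec : ℕ → Set
Spec n = ℕ → Maybe (Term n)

-- substitution of terms for (free) variables; recursion constants are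
-- constants, so substitution does not enter them.
sub : ∀ {n} → (ℕ → Term n) → Term n → Term n
sub ρ (v X)      = ρ X
sub ρ (at a)     = at a
sub ρ (x ⊕ y)    = sub ρ x ⊕ sub ρ y
sub ρ (x ⊙ y)    = sub ρ x ⊙ sub ρ y
sub ρ (x ‖ y)    = sub ρ x ‖ sub ρ y
sub ρ (x ⌊⌊ y)   = sub ρ x ⌊⌊ sub ρ y
sub ρ (x ∣ᶜ y)   = sub ρ x ∣ᶜ sub ρ y
sub ρ (σ x)      = σ (sub ρ x)
sub ρ (∂[ H ] x) = ∂[ H ] (sub ρ x)
sub ρ (τ[ I ] x) = τ[ I ] (sub ρ x)
sub ρ (ν x)      = ν (sub ρ x)
sub ρ (rec E X)  = rec E X

data AllVars {n} (Q : ℕ → Set) : Term n → Set where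
  v    : ∀ {X} → Q X → AllVars Q (v X)
  at   : ∀ {a} → AllVars Q (at a)
  _⊕_  : ∀ {x y} → AllVars Q x → AllVars Q y → AllVars Q (x ⊕ y)
  _⊙_  : ∀ {x y} → AllVars Q x → AllVars Q y → AllVars Q (x ⊙ y)
  _‖_  : ∀ {x y} → AllVars Q x → AllVars Q y → AllVars Q (x ‖ y)
  _⌊⌊_ : ∀ {x y} → AllVars Q x → AllVars Q y → AllVars Q (x ⌊⌊ y)
  _∣ᶜ_ : ∀ {x y} → AllVars Q x → AllVars Q y → AllVars Q (x ∣ᶜ y)
  σ    : ∀ {x} → AllVars Q x → AllVars Q (σ x)
  ∂[_] : ∀ {x} H → AllVars Q x → AllVars Q (∂[ H ] x)
  τ[_] : ∀ {x} I → AllVars Q x → AllVars Q (τ[ I ] x)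
  ν    : ∀ {x} → AllVars Q x → AllVars Q (ν x)
  rec  : ∀ E X → AllVars Q (rec E X)

Closed : ∀ {n} → Term n → Set
Closed = AllVars (λ _ → ⊥)

data NoAbs {n} : Term n → Set where
  v    : ∀ {X} → NoAbs (v X)
  at   : ∀ {a} → NoAbs (at a)
  _⊕_  : ∀ {x y} → NoAbs x → NoAbs y → NoAbs (x ⊕ y)
  _⊙_  : ∀ {x y} → NoAbs x → NoAbs y → NoAbs (x ⊙ y)
  _‖_  : ∀ {x y} → NoAbs x → NoAbs y → NoAbs (x ‖ y)
  _⌊⌊_ : ∀ {x y} → NoAbs x → NoAbs y → NoAbs (x ⌊⌊ y)
  _∣ᶜ_ : ∀ {x y} → NoAbs x → NoAbs y → NoAbs (x ∣ᶜ y)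
  σ    : ∀ {x} → NoAbs x → NoAbs (σ x)
  ∂[_] : ∀ {x} H → NoAbs x → NoAbs (∂[ H ] x)
  ν    : ∀ {x} → NoAbs x → NoAbs (ν x)
  rec  : ∀ {E X} → (∀ j u → E j ≡ just u → NoAbs u) → NoAbs (rec E X)

-- Guardedness.  G g t : every variable occurrence in t is guarded,
-- where g = true means "we are already inside a subterm a̲·t' (a ∈ A)
-- or σ(t')".  No abstraction operator may occur (there is no τ[_]
-- constructor).  Recursion constants are constants (no variable
-- occurrences).

data G {n} : Bool → Term n → Set where
  v    : ∀ {X} → G true (v X)
  at   : ∀ {g a} → G g (at a)
  _⊕_  : ∀ {g x y} → G g x → G g y → G g (x ⊕ y)
  _⊙_  : ∀ {g x y} → G g x → G g y → G g (x ⊙ y)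
  act⊙ : ∀ {g a y} → G true y → G g (at (act a) ⊙ y)
  _‖_  : ∀ {g x y} → G g x → G g y → G g (x ‖ y)
  _⌊⌊_ : ∀ {g x y} → G g x → G g y → G g (x ⌊⌊ y)
  _∣ᶜ_ : ∀ {g x y} → G g x → G g y → G g (x ∣ᶜ y)
  σ    : ∀ {g x} → G true x → G g (σ x)
  ∂[_] : ∀ {g x} H → G g x → G g (∂[ H ] x)
  ν    : ∀ {g x} → G g x → G g (ν x)
  rec  : ∀ {g} E X → G g (rec E X)

Guarded : ∀ {n} → Term n → Set
Guarded = G false

module Axioms {n : ℕ} (γ : Act n → Act n → Act n) where

  private
    δ̲ τ̲ : Term n
    δ̲ = at delta
    τ̲ = at tau

  data Ax : Term n → Term n → Set where
    A1   : ∀ x y → Ax (x ⊕ y) (y ⊕ x)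
    A2   : ∀ x y z → Ax ((x ⊕ y) ⊕ z) (x ⊕ (y ⊕ z))
    A3   : ∀ x → Ax (x ⊕ x) x
    A4   : ∀ x y z → Ax ((x ⊕ y) ⊙ z) (x ⊙ z ⊕ y ⊙ z)
    A5   : ∀ x y z → Ax ((x ⊙ y) ⊙ z) (x ⊙ (y ⊙ z))
    A6   : ∀ x → Ax (x ⊕ δ̲) x
    A7   : ∀ x → Ax (δ̲ ⊙ x) δ̲
    DRT1 : ∀ x y → Ax (σ x ⊕ σ y) (σ (x ⊕ y))
    DRT2 : ∀ x y → Ax (σ x ⊙ y) (σ (x ⊙ y))
    D1   : ∀ H a → ¬ (a ∈ₐ H) → Ax (∂[ H ] (at a)) (at a)
    D2   : ∀ H a → a ∈ₐ H → Ax (∂[ H ] (at a)) δ̲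
    D3   : ∀ H x y → Ax (∂[ H ] (x ⊕ y)) (∂[ H ] x ⊕ ∂[ H ] y)
    D4   : ∀ H x y → Ax (∂[ H ] (x ⊙ y)) (∂[ H ] x ⊙ ∂[ H ] y)
    DRTD : ∀ H x → Ax (∂[ H ] (σ x)) (σ (∂[ H ] x))
    TI1  : ∀ I a → ¬ (a ∈ₐ I) → Ax (τ[ I ] (at a)) (at a)
    TI2  : ∀ I a → a ∈ₐ I → Ax (τ[ I ] (at a)) τ̲
    TI3  : ∀ I x y → Ax (τ[ I ] (x ⊕ y)) (τ[ I ] x ⊕ τ[ I ] y)
    TI4  : ∀ I x y → Ax (τ[ I ] (x ⊙ y)) (τ[ I ] x ⊙ τ[ I ] y)
    DRTT : ∀ I x → Ax (τ[ I ] (σ x)) (σ (τ[ I ] x))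
    CM1  : ∀ x y → Ax (x ‖ y) ((x ⌊⌊ y ⊕ y ⌊⌊ x) ⊕ x ∣ᶜ y)
    CM2  : ∀ a x → Ax (at a ⌊⌊ x) (at a ⊙ x)
    CM3  : ∀ a x y → Ax ((at a ⊙ x) ⌊⌊ y) (at a ⊙ (x ‖ y))
    DCM1 : ∀ x y → Ax (σ x ⌊⌊ ν y) δ̲
    DCM2 : ∀ x y z → Ax (σ x ⌊⌊ (ν y ⊕ σ z)) (σ (x ⌊⌊ z))
    CM4  : ∀ x y z → Ax ((x ⊕ y) ⌊⌊ z) (x ⌊⌊ z ⊕ y ⌊⌊ z)
    CM5  : ∀ a b x → Ax ((at a ⊙ x) ∣ᶜ at b) ((at a ∣ᶜ at b) ⊙ x)
    CM6  : ∀ a b x → Ax (at a ∣ᶜ (at b ⊙ x)) ((at a ∣ᶜ at b) ⊙ x)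
    CM7  : ∀ a b x y → Ax ((at a ⊙ x) ∣ᶜ (at b ⊙ y)) ((at a ∣ᶜ at b) ⊙ (x ‖ y))
    DCM3 : ∀ x y → Ax (ν x ∣ᶜ σ y) δ̲
    DCM4 : ∀ x y → Ax (σ x ∣ᶜ ν y) δ̲
    DCM5 : ∀ x y → Ax (σ x ∣ᶜ σ y) (σ (x ∣ᶜ y))
    CM8  : ∀ x y z → Ax ((x ⊕ y) ∣ᶜ z) (x ∣ᶜ z ⊕ y ∣ᶜ z)
    CM9  : ∀ x y z → Ax (x ∣ᶜ (y ⊕ z)) (x ∣ᶜ y ⊕ x ∣ᶜ z)
    CF   : ∀ a b → Ax (at a ∣ᶜ at b) (at (γ a b))
    NU1  : ∀ a → Ax (ν (at a)) (at a)
    NU2  : ∀ x y → Ax (ν (x ⊕ y)) (ν x ⊕ ν y)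
    NU3  : ∀ x y → Ax (ν (x ⊙ y)) (ν x ⊙ y)
    NU4  : ∀ x → Ax (ν (σ x)) δ̲
    B1   : ∀ a → Ax (at a ⊙ τ̲) (at a)
    B2   : ∀ a x y → Ax (at a ⊙ (τ̲ ⊙ (ν x ⊕ y) ⊕ ν x)) (at a ⊙ (ν x ⊕ y))
    B3   : ∀ a x y → Ax (at a ⊙ (τ̲ ⊙ (ν x ⊕ y) ⊕ y)) (at a ⊙ (ν x ⊕ y))
    B4   : ∀ a x y → Ax (at a ⊙ (σ (τ̲ ⊙ x) ⊕ ν y)) (at a ⊙ (σ x ⊕ ν y))

open Axioms public

data Theory : Set where
  acp bpa : Theory

data Over {n} (T : Theory) (P : Spec n → ℕ → Set) : Term n → Set where
  v    : ∀ {X} → Over T P (v X)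
  at   : ∀ {a} → Over T P (at a)
  _⊕_  : ∀ {x y} → Over T P x → Over T P y → Over T P (x ⊕ y)
  _⊙_  : ∀ {x y} → Over T P x → Over T P y → Over T P (x ⊙ y)
  par  : ∀ {x y} → T ≡ acp → Over T P x → Over T P y → Over T P (x ‖ y)
  lm   : ∀ {x y} → T ≡ acp → Over T P x → Over T P y → Over T P (x ⌊⌊ y)
  cm   : ∀ {x y} → T ≡ acp → Over T P x → Over T P y → Over T P (x ∣ᶜ y)
  σ    : ∀ {x} → Over T P x → Over T P (σ x)
  enc  : ∀ {x} H → T ≡ acp → Over T P x → Over T P (∂[ H ] x)
  τ[_] : ∀ {x} I → Over T P x → Over T P (τ[ I ] x)
  ν    : ∀ {x} → Over T P x → Over T P (ν x)
  rec  : ∀ {E X} → P E X → Over T P (rec E X)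

-- Derivability in conditional equational logic from the axioms of T
-- (instances over the signature) together with, for every recursion
-- constant ⟨X|E⟩ accepted by P, the equation ⟨X|E⟩ = ⟨t|E⟩ (X = t ∈ E)
-- and the conditional equation E ⇒ X = ⟨X|E⟩.
module Derivability {n : ℕ} (γ : Act n → Act n → Act n)
                    (T : Theory) (P : Spec n → ℕ → Set) where

  data Der : Term n → Term n → Set where
    refl′  : ∀ {t} → Over T P t → Der t t
    sym′   : ∀ {s t} → Der s t → Der t s
    trans′ : ∀ {s t u} → Der s t → Der t u → Der s u
    c⊕     : ∀ {x x′ y y′} → Der x x′ → Der y y′ → Der (x ⊕ y) (x′ ⊕ y′)
    c⊙     : ∀ {x x′ y y′} → Der x x′ → Der y y′ → Der (x ⊙ y) (x′ ⊙ y′)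
    c‖     : ∀ {x x′ y y′} → T ≡ acp → Der x x′ → Der y y′ → Der (x ‖ y) (x′ ‖ y′)
    c⌊⌊    : ∀ {x x′ y y′} → T ≡ acp → Der x x′ → Der y y′ → Der (x ⌊⌊ y) (x′ ⌊⌊ y′)
    c∣     : ∀ {x x′ y y′} → T ≡ acp → Der x x′ → Der y y′ → Der (x ∣ᶜ y) (x′ ∣ᶜ y′)
    cσ     : ∀ {x x′} → Der x x′ → Der (σ x) (σ x′)
    c∂     : ∀ {x x′} H → T ≡ acp → Der x x′ → Der (∂[ H ] x) (∂[ H ] x′)
    cτ     : ∀ {x x′} I → Der x x′ → Der (τ[ I ] x) (τ[ I ] x′)
    cν     : ∀ {x x′} → Der x x′ → Der (ν x) (ν x′)
    ax     : ∀ {s t} → Ax γ s t → Over T P s → Over T P t → Der s t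
    rdp    : ∀ {E X t} → P E X → E X ≡ just t → Der (rec E X) (sub (rec E) t)
    rsp    : ∀ {E X} → P E X → (ρ : ℕ → Term n) →
             (∀ j u → E j ≡ just u → Der (ρ j) (sub ρ u)) →
             Der (ρ X) (rec E X)

  -- Rewriting of the right-hand side of X_i in E: using derivable
  -- equations of Φ (in either direction) and/or X_j = t_j (j ≠ i)
  -- left to right, anywhere in the term.
  data Rw (E : Spec n) (i : ℕ) : Term n → Term n → Set where
    rder   : ∀ {s t} → Der s t → Rw E i s t
    runf   : ∀ {j u} → j ≢ i → E j ≡ just u → Rw E i (v j) u
    rrefl  : ∀ {s} → Rw E i s s
    rtrans : ∀ {s t u} → Rw E i s t → Rw E i t u → Rw E i s u
    r⊕     : ∀ {x x′ y y′} → Rw E i x x′ → Rw E i y y′ → Rw E i (x ⊕ y) (x′ ⊕ y′)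
    r⊙     : ∀ {x x′ y y′} → Rw E i x x′ → Rw E i y y′ → Rw E i (x ⊙ y) (x′ ⊙ y′)
    r‖     : ∀ {x x′ y y′} → Rw E i x x′ → Rw E i y y′ → Rw E i (x ‖ y) (x′ ‖ y′)
    r⌊⌊    : ∀ {x x′ y y′} → Rw E i x x′ → Rw E i y y′ → Rw E i (x ⌊⌊ y) (x′ ⌊⌊ y′)
    r∣     : ∀ {x x′ y y′} → Rw E i x x′ → Rw E i y y′ → Rw E i (x ∣ᶜ y) (x′ ∣ᶜ y′)
    rσ     : ∀ {x x′} → Rw E i x x′ → Rw E i (σ x) (σ x′)
    r∂     : ∀ {x x′} H → Rw E i x x′ → Rw E i (∂[ H ] x) (∂[ H ] x′)
    rτ     : ∀ {x x′} I → Rw E i x x′ → Rw E i (τ[ I ] x) (τ[ I ] x′)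
    rν     : ∀ {x x′} → Rw E i x x′ → Rw E i (ν x) (ν x′)

  SpecOver : Spec n → Set
  SpecOver E = ∀ j u → E j ≡ just u →
               Over T P u × AllVars (λ Y → ∃ λ w → E Y ≡ just w) u

  GuardedMod : Spec n → Set
  GuardedMod E = ∀ i u → E i ≡ just u → ∃ λ w → Rw E i u w × Guarded w

open Derivability public

-- The stratified construction of TREC.  RecOK γ T k E X holds iff
-- ⟨X|E⟩ is a recursion constant of Σ_k.

RecOK : ∀ {n} → (Act n → Act n → Act n) → Theory → ℕ → Spec n → ℕ → Set
RecOK γ T zero    E X = ⊥
RecOK γ T (suc k) E X =
  RecOK γ T k E X ⊎
  ((∃ λ t → E X ≡ just t) ×
   SpecOver γ T (RecOK γ T k) E ×
   GuardedMod γ T (RecOK γ T k) E)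

RecC : ∀ {n} → (Act n → Act n → Act n) → Theory → Spec n → ℕ → Set
RecC γ T E X = ∃ λ k → RecOK γ T k E X

TermOf : ∀ {n} → (Act n → Act n → Act n) → Theory → Term n → Set
TermOf γ T = Over T (RecC γ T)

Derivable : ∀ {n} → (Act n → Act n → Act n) → Theory → Term n → Term n → Set
Derivable γ T = Der γ T (RecC γ T)

{-# OPTIONS --safe #-}

-- Every closed term without abstraction (recursion constants being opaque)
-- equals a finite sum of summands a, a·t (a ∈ A), τ·s and σ(t), where s is
-- again such a sum: for ⟨X|E⟩ one passes to the guarded term to which the
-- right-hand side of X rewrites, whose unguarded recursion constants lie in a
-- lower stratum.  The tails t are again closed terms without abstraction, so
-- iterating this exhibits the given term as a solution of an infinite recursive
-- specification over BPA which is literally guarded, and RSP applies.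
-- A communication of two actions of A into τ could create infinite τ-paths.
-- But if γ(a,b) = τ, then X = (a·X ∣ b) is guarded and reads X = τ·X, which is
-- solved by every τ·x; hence all τ·x are equal to τ.

module Submission where

open import Defs
open import Data.Nat using (ℕ; suc)
open import Data.Nat.Binary using (ℕᵇ; 2[1+_]; 1+[2_]; toℕ; fromℕ) renaming (zero to 0ᵇ)
open import Data.Nat.Binary.Properties using (fromℕ-toℕ)
open import Data.Bool using (Bool; true; false)
open import Data.Maybe using (just; nothing; maybe)
open import Data.Fin.Subset.Properties using (_∈?_)
open import Data.Product using (Σ; ∃; _×_; _,_; proj₁; proj₂)
open import Data.Sum using (_⊎_; inj₁; inj₂)
open import Function using (_∘_; id)
open import Relation.Nullary using (yes; no)
open import Relation.Binary.PropositionalEquality using (_≡_; refl; sym; trans; cong; cong₂; subst)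

-- Substitution

sub-∘ : ∀ {n} (ρ ρ′ : ℕ → Term n) t → sub ρ (sub ρ′ t) ≡ sub (sub ρ ∘ ρ′) t
sub-∘ ρ ρ′ (v X)      = refl
sub-∘ ρ ρ′ (at a)     = refl
sub-∘ ρ ρ′ (x ⊕ y)    = cong₂ _⊕_ (sub-∘ ρ ρ′ x) (sub-∘ ρ ρ′ y)
sub-∘ ρ ρ′ (x ⊙ y)    = cong₂ _⊙_ (sub-∘ ρ ρ′ x) (sub-∘ ρ ρ′ y)
sub-∘ ρ ρ′ (x ‖ y)    = cong₂ _‖_ (sub-∘ ρ ρ′ x) (sub-∘ ρ ρ′ y)
sub-∘ ρ ρ′ (x ⌊⌊ y)   = cong₂ _⌊⌊_ (sub-∘ ρ ρ′ x) (sub-∘ ρ ρ′ y)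
sub-∘ ρ ρ′ (x ∣ᶜ y)   = cong₂ _∣ᶜ_ (sub-∘ ρ ρ′ x) (sub-∘ ρ ρ′ y)
sub-∘ ρ ρ′ (σ x)      = cong σ (sub-∘ ρ ρ′ x)
sub-∘ ρ ρ′ (∂[ H ] x) = cong ∂[ H ] (sub-∘ ρ ρ′ x)
sub-∘ ρ ρ′ (τ[ I ] x) = cong τ[ I ] (sub-∘ ρ ρ′ x)
sub-∘ ρ ρ′ (ν x)      = cong ν (sub-∘ ρ ρ′ x)
sub-∘ ρ ρ′ (rec E X)  = refl

sub-cong : ∀ {n} {Q : ℕ → Set} {ρ ρ′ : ℕ → Term n} → (∀ Y → Q Y → ρ Y ≡ ρ′ Y) →
           ∀ {t} → AllVars Q t → sub ρ t ≡ sub ρ′ t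
sub-cong e (v q)      = e _ q
sub-cong e at         = refl
sub-cong e (x ⊕ y)    = cong₂ _⊕_ (sub-cong e x) (sub-cong e y)
sub-cong e (x ⊙ y)    = cong₂ _⊙_ (sub-cong e x) (sub-cong e y)
sub-cong e (x ‖ y)    = cong₂ _‖_ (sub-cong e x) (sub-cong e y)
sub-cong e (x ⌊⌊ y)   = cong₂ _⌊⌊_ (sub-cong e x) (sub-cong e y)
sub-cong e (x ∣ᶜ y)   = cong₂ _∣ᶜ_ (sub-cong e x) (sub-cong e y)
sub-cong e (σ x)      = cong σ (sub-cong e x)
sub-cong e (∂[ H ] x) = cong ∂[ H ] (sub-cong e x)
sub-cong e (τ[ I ] x) = cong τ[ I ] (sub-cong e x)
sub-cong e (ν x)      = cong ν (sub-cong e x)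
sub-cong e (rec E X)  = refl

_⊆_ : ∀ {n} (P P′ : Spec n → ℕ → Set) → Set
P ⊆ P′ = ∀ {E X} → P E X → P′ E X

Over-sub : ∀ {n T} {P P′ : Spec n → ℕ → Set} {ρ} → P ⊆ P′ → (∀ Y → Over T P′ (ρ Y)) →
           ∀ {t} → Over T P t → Over T P′ (sub ρ t)
Over-sub i r v           = r _
Over-sub i r at          = at
Over-sub i r (x ⊕ y)     = Over-sub i r x ⊕ Over-sub i r y
Over-sub i r (x ⊙ y)     = Over-sub i r x ⊙ Over-sub i r y
Over-sub i r (par e x y) = par e (Over-sub i r x) (Over-sub i r y)
Over-sub i r (lm e x y)  = lm e (Over-sub i r x) (Over-sub i r y)
Over-sub i r (cm e x y)  = cm e (Over-sub i r x) (Over-sub i r y)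
Over-sub i r (σ x)       = σ (Over-sub i r x)
Over-sub i r (enc H e x) = enc H e (Over-sub i r x)
Over-sub i r (τ[ I ] x)  = τ[ I ] (Over-sub i r x)
Over-sub i r (ν x)       = ν (Over-sub i r x)
Over-sub i r (rec p)     = rec (i p)

-- Variables outside vars(E), which may be introduced by rewriting the
-- right-hand sides of E, are sent to δ, since ⟨Y|E⟩ is not a term for them.
close : ∀ {n} → Spec n → ℕ → Term n
close E Y = maybe (λ _ → rec E Y) (at delta) (E Y)

close-just : ∀ {n} (E : Spec n) Y → (∃ λ u → E Y ≡ just u) → close E Y ≡ rec E Y
close-just E Y (_ , e) rewrite e = refl

close-elim : ∀ {n} (Q : Term n → Set) (E : Spec n) → (∀ Y → (∃ λ u → E Y ≡ just u) → Q (rec E Y)) →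
             Q (at delta) → ∀ Y → Q (close E Y)
close-elim Q E r d Y with E Y in e
... | just u  = r Y (u , e)
... | nothing = d

module Normalisation {n : ℕ} (γ : Act n → Act n → Act n)
                     (γ-tau : ∀ a → γ tau a ≡ delta) (γ-delta : ∀ a → γ delta a ≡ delta) where

  -- Derivations under substitution

  Ax-sub : ∀ ρ {s t} → Ax γ s t → Ax γ (sub ρ s) (sub ρ t)
  Ax-sub ρ (A1 x y)      = A1 _ _
  Ax-sub ρ (A2 x y z)    = A2 _ _ _
  Ax-sub ρ (A3 x)        = A3 _
  Ax-sub ρ (A4 x y z)    = A4 _ _ _
  Ax-sub ρ (A5 x y z)    = A5 _ _ _
  Ax-sub ρ (A6 x)        = A6 _
  Ax-sub ρ (A7 x)        = A7 _
  Ax-sub ρ (DRT1 x y)    = DRT1 _ _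
  Ax-sub ρ (DRT2 x y)    = DRT2 _ _
  Ax-sub ρ (D1 H a p)    = D1 H a p
  Ax-sub ρ (D2 H a p)    = D2 H a p
  Ax-sub ρ (D3 H x y)    = D3 H _ _
  Ax-sub ρ (D4 H x y)    = D4 H _ _
  Ax-sub ρ (DRTD H x)    = DRTD H _
  Ax-sub ρ (TI1 I a p)   = TI1 I a p
  Ax-sub ρ (TI2 I a p)   = TI2 I a p
  Ax-sub ρ (TI3 I x y)   = TI3 I _ _
  Ax-sub ρ (TI4 I x y)   = TI4 I _ _
  Ax-sub ρ (DRTT I x)    = DRTT I _
  Ax-sub ρ (CM1 x y)     = CM1 _ _
  Ax-sub ρ (CM2 a x)     = CM2 a _
  Ax-sub ρ (CM3 a x y)   = CM3 a _ _
  Ax-sub ρ (DCM1 x y)    = DCM1 _ _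
  Ax-sub ρ (DCM2 x y z)  = DCM2 _ _ _
  Ax-sub ρ (CM4 x y z)   = CM4 _ _ _
  Ax-sub ρ (CM5 a b x)   = CM5 a b _
  Ax-sub ρ (CM6 a b x)   = CM6 a b _
  Ax-sub ρ (CM7 a b x y) = CM7 a b _ _
  Ax-sub ρ (DCM3 x y)    = DCM3 _ _
  Ax-sub ρ (DCM4 x y)    = DCM4 _ _
  Ax-sub ρ (DCM5 x y)    = DCM5 _ _
  Ax-sub ρ (CM8 x y z)   = CM8 _ _ _
  Ax-sub ρ (CM9 x y z)   = CM9 _ _ _
  Ax-sub ρ (CF a b)      = CF a b
  Ax-sub ρ (NU1 a)       = NU1 a
  Ax-sub ρ (NU2 x y)     = NU2 _ _
  Ax-sub ρ (NU3 x y)     = NU3 _ _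
  Ax-sub ρ (NU4 x)       = NU4 _
  Ax-sub ρ (B1 a)        = B1 a
  Ax-sub ρ (B2 a x y)    = B2 a _ _
  Ax-sub ρ (B3 a x y)    = B3 a _ _
  Ax-sub ρ (B4 a x y)    = B4 a _ _

  -- Every `ρ Y` has to be a term of the signature, since a derivation may pass through variables
  -- absent from its end terms. Recursion constants absorb `ρ`, and `rsp` is applied to the given
  -- solution composed with `ρ`.
  Der-sub : ∀ {T} {P P′ : Spec n → ℕ → Set} {ρ} → P ⊆ P′ → (∀ Y → Over T P′ (ρ Y)) →
            ∀ {s t} → Der γ T P s t → Der γ T P′ (sub ρ s) (sub ρ t)
  Der-sub i r (refl′ o)        = refl′ (Over-sub i r o)
  Der-sub i r (sym′ d)         = sym′ (Der-sub i r d)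
  Der-sub i r (trans′ d e)     = trans′ (Der-sub i r d) (Der-sub i r e)
  Der-sub i r (c⊕ d e)         = c⊕ (Der-sub i r d) (Der-sub i r e)
  Der-sub i r (c⊙ d e)         = c⊙ (Der-sub i r d) (Der-sub i r e)
  Der-sub i r (c‖ q d e)       = c‖ q (Der-sub i r d) (Der-sub i r e)
  Der-sub i r (c⌊⌊ q d e)      = c⌊⌊ q (Der-sub i r d) (Der-sub i r e)
  Der-sub i r (c∣ q d e)       = c∣ q (Der-sub i r d) (Der-sub i r e)
  Der-sub i r (cσ d)           = cσ (Der-sub i r d)
  Der-sub i r (c∂ H q d)       = c∂ H q (Der-sub i r d)
  Der-sub i r (cτ I d)         = cτ I (Der-sub i r d)
  Der-sub i r (cν d)           = cν (Der-sub i r d)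
  Der-sub i r (ax a o o′)      = ax (Ax-sub _ a) (Over-sub i r o) (Over-sub i r o′)
  Der-sub {ρ = ρ} i r (rdp {E} {t = t} p e) =
    subst (Der γ _ _ _) (sym (sub-∘ ρ (rec E) t)) (rdp (i p) e)
  Der-sub {ρ = ρ} i r (rsp p ρ′ h) =
    rsp (i p) (sub ρ ∘ ρ′)
        (λ j u e → subst (Der γ _ _ _) (sub-∘ ρ ρ′ u) (Der-sub i r (h j u e)))

  -- Strata of recursion constants

  RecOK-vars : ∀ {T} k {E X} → RecOK γ T k E X → ∃ λ u → E X ≡ just u
  RecOK-vars (suc k) (inj₁ p)       = RecOK-vars k p
  RecOK-vars (suc k) (inj₂ (d , _)) = d

  unfold-Over : ∀ {T} k {P} → RecOK γ T k ⊆ P → ∀ {E X t} →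
                RecOK γ T k E X → E X ≡ just t → Over T P (sub (rec E) t)
  unfold-Over (suc k) i (inj₁ p) e = unfold-Over k (i ∘ inj₁) p e
  unfold-Over {T} (suc k) {P} i {E} {t = t} (inj₂ (_ , so , gm)) e =
    subst (Over T P) (sub-cong (close-just E) (proj₂ (so _ _ e)))
      (Over-sub (i ∘ inj₁)
        (close-elim (Over T P) E (λ Y d → rec (i (inj₂ (d , so , gm)))) at)
        (proj₁ (so _ _ e)))

  Der-Over : ∀ {T} k {s t} → Der γ T (RecOK γ T k) s t →
             Over T (RecOK γ T k) s × Over T (RecOK γ T k) t
  Der-Over k (refl′ o)    = o , o
  Der-Over k (sym′ d)     = let o , o′ = Der-Over k d in o′ , o
  Der-Over k (trans′ d e) = proj₁ (Der-Over k d) , proj₂ (Der-Over k e)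
  Der-Over k (c⊕ d e)     = let o , o′ = Der-Over k d ; q , q′ = Der-Over k e in o ⊕ q , o′ ⊕ q′
  Der-Over k (c⊙ d e)     = let o , o′ = Der-Over k d ; q , q′ = Der-Over k e in o ⊙ q , o′ ⊙ q′
  Der-Over k (c‖ r d e)   = let o , o′ = Der-Over k d ; q , q′ = Der-Over k e in par r o q , par r o′ q′
  Der-Over k (c⌊⌊ r d e)  = let o , o′ = Der-Over k d ; q , q′ = Der-Over k e in lm r o q , lm r o′ q′
  Der-Over k (c∣ r d e)   = let o , o′ = Der-Over k d ; q , q′ = Der-Over k e in cm r o q , cm r o′ q′
  Der-Over k (cσ d)       = let o , o′ = Der-Over k d in σ o , σ o′
  Der-Over k (c∂ H r d)   = let o , o′ = Der-Over k d in enc H r o , enc H r o′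
  Der-Over k (cτ I d)     = let o , o′ = Der-Over k d in τ[ I ] o , τ[ I ] o′
  Der-Over k (cν d)       = let o , o′ = Der-Over k d in ν o , ν o′
  Der-Over k (ax a o o′)  = o , o′
  Der-Over k (rdp p e)    = rec p , unfold-Over k id p e
  -- `RecOK-vars` supplies the equation of `X` in `E`; the premise `h` for it shows that `ρ X` is a
  -- term.
  Der-Over k (rsp p ρ h)  = let u , e = RecOK-vars k p in proj₁ (Der-Over k (h _ u e)) , rec p

  Rec : Spec n → ℕ → Set
  Rec = RecC γ acp

  Ov : Term n → Set
  Ov = TermOf γ acp

  infix 4 _≈_
  _≈_ : Term n → Term n → Set
  _≈_ = Derivable γ acp

  -- Derivation steps carry over by `Der-sub`, unfolding steps by `rdp`. The first component keeps
  -- the rewritten term within stratum `k`, which the induction on strata needs.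
  Rw-sound : ∀ k {E i} → SpecOver γ acp (RecOK γ acp k) E →
             (∀ Y → (∃ λ u → E Y ≡ just u) → Rec E Y) →
             ∀ {s t} → Rw γ acp (RecOK γ acp k) E i s t → Over acp (RecOK γ acp k) s →
             Over acp (RecOK γ acp k) t × sub (close E) s ≈ sub (close E) t
  Rw-sound k {E} {i} so r = go
    where
    closed-Over : ∀ Y → Ov (close E Y)
    closed-Over = close-elim Ov E (λ Y d → rec (r Y d)) at

    go : ∀ {s t} → Rw γ acp (RecOK γ acp k) E i s t → Over acp (RecOK γ acp k) s →
         Over acp (RecOK γ acp k) t × sub (close E) s ≈ sub (close E) t
    go (rder d) o = proj₂ (Der-Over k d) , Der-sub (k ,_) closed-Over d
    go (runf {j} {u} _ e) o =
      proj₁ (so j u e) ,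
      subst (_≈ sub (close E) u) (sym (close-just E j (u , e)))
        (subst (rec E j ≈_) (sym (sub-cong (close-just E) (proj₂ (so j u e)))) (rdp (r j (u , e)) e))
    go rrefl o = o , refl′ (Over-sub (k ,_) closed-Over o)
    go (rtrans p q) o = let o₁ , d = go p o ; o₂ , e = go q o₁ in o₂ , trans′ d e
    go (r⊕ p q) (x ⊕ y) = let x′ , d = go p x ; y′ , e = go q y in x′ ⊕ y′ , c⊕ d e
    go (r⊙ p q) (x ⊙ y) = let x′ , d = go p x ; y′ , e = go q y in x′ ⊙ y′ , c⊙ d e
    go (r‖ p q) (par z x y) = let x′ , d = go p x ; y′ , e = go q y in par z x′ y′ , c‖ z d e
    go (r⌊⌊ p q) (lm z x y) = let x′ , d = go p x ; y′ , e = go q y in lm z x′ y′ , c⌊⌊ z d e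
    go (r∣ p q) (cm z x y) = let x′ , d = go p x ; y′ , e = go q y in cm z x′ y′ , c∣ z d e
    go (rσ p) (σ x) = let x′ , d = go p x in σ x′ , cσ d
    go (r∂ H p) (enc _ z x) = let x′ , d = go p x in enc H z x′ , c∂ H z d
    go (rτ I p) (τ[ _ ] x) = let x′ , d = go p x in τ[ I ] x′ , cτ I d
    go (rν p) (ν x) = let x′ , d = go p x in ν x′ , cν d

  -- Closed terms without abstraction and their normal forms

  -- Only the recursion constants at unguarded positions are restricted to P.
  data Proc (P : Spec n → ℕ → Set) : Term n → Set where
    at   : ∀ {a} → Proc P (at a)
    _⊕_  : ∀ {x y} → Proc P x → Proc P y → Proc P (x ⊕ y)
    _⊙_  : ∀ {x y} → Proc P x → Proc P y → Proc P (x ⊙ y)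
    act⊙ : ∀ {a y} → Proc Rec y → Proc P (at (act a) ⊙ y)
    _‖_  : ∀ {x y} → Proc P x → Proc P y → Proc P (x ‖ y)
    _⌊⌊_ : ∀ {x y} → Proc P x → Proc P y → Proc P (x ⌊⌊ y)
    _∣ᶜ_ : ∀ {x y} → Proc P x → Proc P y → Proc P (x ∣ᶜ y)
    σ    : ∀ {x} → Proc Rec x → Proc P (σ x)
    ∂[_] : ∀ {x} H → Proc P x → Proc P (∂[ H ] x)
    ν    : ∀ {x} → Proc P x → Proc P (ν x)
    rec  : ∀ {E X} → P E X → Proc P (rec E X)

  Process : Term n → Set
  Process = Proc Rec

  Proc⇒Process : ∀ {P} → P ⊆ Rec → ∀ {t} → Proc P t → Process t
  Proc⇒Process i at         = at
  Proc⇒Process i (x ⊕ y)    = Proc⇒Process i x ⊕ Proc⇒Process i y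
  Proc⇒Process i (x ⊙ y)    = Proc⇒Process i x ⊙ Proc⇒Process i y
  Proc⇒Process i (act⊙ y)   = at ⊙ y
  Proc⇒Process i (x ‖ y)    = Proc⇒Process i x ‖ Proc⇒Process i y
  Proc⇒Process i (x ⌊⌊ y)   = Proc⇒Process i x ⌊⌊ Proc⇒Process i y
  Proc⇒Process i (x ∣ᶜ y)   = Proc⇒Process i x ∣ᶜ Proc⇒Process i y
  Proc⇒Process i (σ x)      = σ x
  Proc⇒Process i (∂[ H ] x) = ∂[ H ] (Proc⇒Process i x)
  Proc⇒Process i (ν x)      = ν (Proc⇒Process i x)
  Proc⇒Process i (rec p)    = rec (i p)

  Process⇒Over : ∀ {t} → Process t → Ov t
  Process⇒Over at         = at
  Process⇒Over (x ⊕ y)    = Process⇒Over x ⊕ Process⇒Over y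
  Process⇒Over (x ⊙ y)    = Process⇒Over x ⊙ Process⇒Over y
  Process⇒Over (act⊙ y)   = at ⊙ Process⇒Over y
  Process⇒Over (x ‖ y)    = par refl (Process⇒Over x) (Process⇒Over y)
  Process⇒Over (x ⌊⌊ y)   = lm refl (Process⇒Over x) (Process⇒Over y)
  Process⇒Over (x ∣ᶜ y)   = cm refl (Process⇒Over x) (Process⇒Over y)
  Process⇒Over (σ x)      = σ (Process⇒Over x)
  Process⇒Over (∂[ H ] x) = enc H refl (Process⇒Over x)
  Process⇒Over (ν x)      = ν (Process⇒Over x)
  Process⇒Over (rec p)    = rec p

  NoAbs⇒Process : ∀ {t} → Closed t → Ov t → NoAbs t → Process t
  NoAbs⇒Process at at at = at
  NoAbs⇒Process (c ⊕ d) (x ⊕ y) (p ⊕ q) = NoAbs⇒Process c x p ⊕ NoAbs⇒Process d y q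
  NoAbs⇒Process (c ⊙ d) (x ⊙ y) (p ⊙ q) = NoAbs⇒Process c x p ⊙ NoAbs⇒Process d y q
  NoAbs⇒Process (c ‖ d) (par _ x y) (p ‖ q) = NoAbs⇒Process c x p ‖ NoAbs⇒Process d y q
  NoAbs⇒Process (c ⌊⌊ d) (lm _ x y) (p ⌊⌊ q) = NoAbs⇒Process c x p ⌊⌊ NoAbs⇒Process d y q
  NoAbs⇒Process (c ∣ᶜ d) (cm _ x y) (p ∣ᶜ q) = NoAbs⇒Process c x p ∣ᶜ NoAbs⇒Process d y q
  NoAbs⇒Process (σ c) (σ x) (σ p) = σ (NoAbs⇒Process c x p)
  NoAbs⇒Process (∂[ H ] c) (enc _ _ x) (∂[ _ ] p) = ∂[ H ] (NoAbs⇒Process c x p)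
  NoAbs⇒Process (ν c) (ν x) (ν p) = ν (NoAbs⇒Process c x p)
  NoAbs⇒Process (rec _ _) (rec r) (rec _) = rec r

  Scope : Bool → (Spec n → ℕ → Set) → Spec n → ℕ → Set
  Scope true  P = Rec
  Scope false P = P

  -- Variables of a guarded term occur only where the flag is `true`, and there `Scope` admits all
  -- constants. So substituting constants of the specification itself adds nothing at unguarded
  -- positions. Abstraction is excluded by `G`.
  G⇒Proc : ∀ {P ρ} → P ⊆ Rec → (∀ Y → Process (ρ Y)) →
           ∀ {g t} → G g t → Over acp P t → Proc (Scope g P) (sub ρ t)
  G⇒Proc i r v v = r _
  G⇒Proc i r at at = at
  G⇒Proc i r (x ⊕ y) (p ⊕ q) = G⇒Proc i r x p ⊕ G⇒Proc i r y q
  G⇒Proc i r (x ⊙ y) (p ⊙ q) = G⇒Proc i r x p ⊙ G⇒Proc i r y q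
  G⇒Proc i r (act⊙ y) (at ⊙ q) = act⊙ (G⇒Proc i r y q)
  G⇒Proc i r (x ‖ y) (par _ p q) = G⇒Proc i r x p ‖ G⇒Proc i r y q
  G⇒Proc i r (x ⌊⌊ y) (lm _ p q) = G⇒Proc i r x p ⌊⌊ G⇒Proc i r y q
  G⇒Proc i r (x ∣ᶜ y) (cm _ p q) = G⇒Proc i r x p ∣ᶜ G⇒Proc i r y q
  G⇒Proc i r (σ x) (σ p) = σ (G⇒Proc i r x p)
  G⇒Proc i r (∂[ H ] x) (enc _ _ p) = ∂[ H ] (G⇒Proc i r x p)
  G⇒Proc i r (ν x) (ν p) = ν (G⇒Proc i r x p)
  G⇒Proc i r {true} (rec _ _) (rec p) = rec (i p)
  G⇒Proc i r {false} (rec _ _) (rec p) = rec p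

  mutual
    -- The tail behind τ must be normal because τ is not a guard; behind `act a` or σ an arbitrary
    -- process stays unevaluated. `Tail delta` is empty, so products starting with δ have to be
    -- eliminated.
    data Nf : Term n → Set where
      atom : ∀ a → Nf (at a)
      pre  : ∀ {a t} → Tail a t → Nf (at a ⊙ t)
      _⊕_  : ∀ {s t} → Nf s → Nf t → Nf (s ⊕ t)
      σ    : ∀ {t} → Process t → Nf (σ t)

    data Tail : Act n → Term n → Set where
      act : ∀ {a t} → Process t → Tail (act a) t
      tau : ∀ {t} → Nf t → Tail tau t

  mutual
    Nf⇒Process : ∀ {t} → Nf t → Process t
    Nf⇒Process (atom a) = at
    Nf⇒Process (pre x)  = at ⊙ Tail⇒Process x
    Nf⇒Process (x ⊕ y)  = Nf⇒Process x ⊕ Nf⇒Process y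
    Nf⇒Process (σ x)    = σ x

    Tail⇒Process : ∀ {a t} → Tail a t → Process t
    Tail⇒Process (act x) = x
    Tail⇒Process (tau x) = Nf⇒Process x

  Nf⇒Over : ∀ {t} → Nf t → Ov t
  Nf⇒Over p = Process⇒Over (Nf⇒Process p)

  Tail⇒Over : ∀ {a t} → Tail a t → Ov t
  Tail⇒Over x = Process⇒Over (Tail⇒Process x)

  HasNf : Term n → Set
  HasNf t = ∃ λ s → Nf s × t ≈ s

  -- Instance search discharges the signature conditions of axiom instances; local instances supply
  -- them for the subterms.
  instance
    Ov-at : ∀ {a} → Ov (at a)
    Ov-at = at
    Ov-⊕ : ∀ {x y} → ⦃ Ov x ⦄ → ⦃ Ov y ⦄ → Ov (x ⊕ y)
    Ov-⊕ ⦃ o ⦄ ⦃ q ⦄ = o ⊕ q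
    Ov-⊙ : ∀ {x y} → ⦃ Ov x ⦄ → ⦃ Ov y ⦄ → Ov (x ⊙ y)
    Ov-⊙ ⦃ o ⦄ ⦃ q ⦄ = o ⊙ q
    Ov-‖ : ∀ {x y} → ⦃ Ov x ⦄ → ⦃ Ov y ⦄ → Ov (x ‖ y)
    Ov-‖ ⦃ o ⦄ ⦃ q ⦄ = par refl o q
    Ov-⌊⌊ : ∀ {x y} → ⦃ Ov x ⦄ → ⦃ Ov y ⦄ → Ov (x ⌊⌊ y)
    Ov-⌊⌊ ⦃ o ⦄ ⦃ q ⦄ = lm refl o q
    Ov-∣ : ∀ {x y} → ⦃ Ov x ⦄ → ⦃ Ov y ⦄ → Ov (x ∣ᶜ y)
    Ov-∣ ⦃ o ⦄ ⦃ q ⦄ = cm refl o q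
    Ov-σ : ∀ {x} → ⦃ Ov x ⦄ → Ov (σ x)
    Ov-σ ⦃ o ⦄ = σ o
    Ov-∂ : ∀ {H x} → ⦃ Ov x ⦄ → Ov (∂[ H ] x)
    Ov-∂ ⦃ o ⦄ = enc _ refl o
    Ov-ν : ∀ {x} → ⦃ Ov x ⦄ → Ov (ν x)
    Ov-ν ⦃ o ⦄ = ν o

  by : ∀ {s t} → Ax γ s t → ⦃ Ov s ⦄ → ⦃ Ov t ⦄ → s ≈ t
  by a ⦃ o ⦄ ⦃ q ⦄ = ax a o q

  rfl : ∀ {t} → ⦃ Ov t ⦄ → t ≈ t
  rfl ⦃ o ⦄ = refl′ o

  infixr 2 _⟨≈⟩_
  _⟨≈⟩_ : ∀ {s t u} → s ≈ t → t ≈ u → s ≈ u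
  _⟨≈⟩_ = trans′

  infixr 1 _◃_
  _◃_ : ∀ {s t} → s ≈ t → HasNf t → HasNf s
  d ◃ (u , p , e) = u , p , (d ⟨≈⟩ e)

  nf : ∀ {t} → Nf t → HasNf t
  nf p = _ , p , refl′ (Nf⇒Over p)

  -- Normal forms under the sequential operators, time-out and encapsulation

  δ-nf : HasNf (at delta)
  δ-nf = nf (atom delta)

  ⊕-nf : ∀ {s t} → HasNf s → HasNf t → HasNf (s ⊕ t)
  ⊕-nf (_ , p , d) (_ , q , e) = _ , p ⊕ q , c⊕ d e

  τ-nf : ∀ {t} → HasNf t → HasNf (at tau ⊙ t)
  τ-nf (_ , p , d) = _ , pre (tau p) , c⊙ rfl d

  -- The right factor is needed in two forms: as the process `q` behind a guard, and in normal form,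
  -- by `h`, directly after τ.
  ⊙-nf : ∀ {s t} → Nf s → Process t → HasNf t → HasNf (s ⊙ t)
  ⊙-nf (atom (act a)) q h = nf (pre (act q))
  ⊙-nf (atom tau) q h = τ-nf h
  ⊙-nf (atom delta) q h = by (A7 _) ◃ δ-nf
    where instance _ = Process⇒Over q
  ⊙-nf (pre (act x)) q h = by (A5 _ _ _) ◃ nf (pre (act (x ⊙ q)))
    where instance _ = Process⇒Over q
                   _ = Process⇒Over x
  ⊙-nf (pre (tau p)) q h = by (A5 _ _ _) ◃ τ-nf (⊙-nf p q h)
    where instance _ = Process⇒Over q
                   _ = Nf⇒Over p
  ⊙-nf (p₁ ⊕ p₂) q h = by (A4 _ _ _) ◃ ⊕-nf (⊙-nf p₁ q h) (⊙-nf p₂ q h)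
    where instance _ = Process⇒Over q
                   _ = Nf⇒Over p₁
                   _ = Nf⇒Over p₂
  ⊙-nf (σ x) q h = by (DRT2 _ _) ◃ nf (σ (x ⊙ q))
    where instance _ = Process⇒Over q
                   _ = Process⇒Over x

  ν-prefix : ∀ {a x} → ⦃ Ov x ⦄ → ν (at a ⊙ x) ≈ at a ⊙ x
  ν-prefix = by (NU3 _ _) ⟨≈⟩ c⊙ (by (NU1 _)) rfl

  ν-nf : ∀ {s} → Nf s → HasNf (ν s)
  ν-nf (atom a) = by (NU1 a) ◃ nf (atom a)
  ν-nf (pre x) = ν-prefix ◃ nf (pre x)
    where instance _ = Tail⇒Over x
  ν-nf (p ⊕ q) = by (NU2 _ _) ◃ ⊕-nf (ν-nf p) (ν-nf q)
    where instance _ = Nf⇒Over p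
                   _ = Nf⇒Over q
  ν-nf (σ x) = by (NU4 _) ◃ δ-nf
    where instance _ = Process⇒Over x

  ∂-act : ∀ H a → ∂[ H ] (at (act a)) ≈ at (act a) ⊎ ∂[ H ] (at (act a)) ≈ at delta
  ∂-act H a with a ∈? H
  ... | yes p = inj₂ (by (D2 H _ p))
  ... | no ¬p = inj₁ (by (D1 H _ ¬p))

  ∂-nf : ∀ H {s} → Nf s → HasNf (∂[ H ] s)
  ∂-nf H (atom (act a)) with ∂-act H a
  ... | inj₁ d = d ◃ nf (atom _)
  ... | inj₂ d = d ◃ δ-nf
  ∂-nf H (atom tau) = by (D1 H tau id) ◃ nf (atom tau)
  ∂-nf H (atom delta) = by (D1 H delta id) ◃ δ-nf
  ∂-nf H (pre {act a} (act x)) with ∂-act H a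
  ... | inj₁ d = by (D4 H _ _) ⟨≈⟩ c⊙ d rfl ◃ nf (pre (act (∂[ H ] x)))
    where instance _ = Process⇒Over x
  ... | inj₂ d = by (D4 H _ _) ⟨≈⟩ c⊙ d rfl ⟨≈⟩ by (A7 _) ◃ δ-nf
    where instance _ = Process⇒Over x
  ∂-nf H (pre (tau p)) = by (D4 H _ _) ⟨≈⟩ c⊙ (by (D1 H tau id)) rfl ◃ τ-nf (∂-nf H p)
    where instance _ = Nf⇒Over p
  ∂-nf H (p ⊕ q) = by (D3 H _ _) ◃ ⊕-nf (∂-nf H p) (∂-nf H q)
    where instance _ = Nf⇒Over p
                   _ = Nf⇒Over q
  ∂-nf H (σ x) = by (DRTD H _) ◃ nf (σ (∂[ H ] x))
    where instance _ = Process⇒Over x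

  -- Merge

  τ-collapse : ∀ {a b x} → γ (act a) b ≡ tau → ⦃ Ov x ⦄ → at tau ⊙ x ≈ at tau
  -- `solution` is taken at `x` and then at `at tau`: τ·x and τ·τ both equal the constant, and `B1`
  -- reduces τ·τ to τ.
  τ-collapse {a} {b} e = solution ⟨≈⟩ sym′ solution ⟨≈⟩ by (B1 tau)
    where
    E : Spec n
    E _ = just ((at (act a) ⊙ v 0) ∣ᶜ at b)

    E-Rec : Rec E 0
    E-Rec = 1 , inj₂ ((_ , refl) ,
      (λ { _ _ refl → cm refl (at ⊙ v) at , (at ⊙ v (_ , refl)) ∣ᶜ at }) ,
      (λ { _ _ refl → _ , rrefl , act⊙ v ∣ᶜ at }))

    τ-step : ∀ {x} → ⦃ Ov x ⦄ → (at (act a) ⊙ (at tau ⊙ x)) ∣ᶜ at b ≈ at tau ⊙ x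
    τ-step =
      -- (a·(τ·x)) ∣ b = (a ∣ b)·(τ·x) = τ·(τ·x) = (τ·τ)·x = τ·x.
      by (CM5 _ _ _) ⟨≈⟩ c⊙ (subst (λ c → at (act a) ∣ᶜ at b ≈ at c) e (by (CF _ _))) rfl
      ⟨≈⟩ sym′ (by (A5 _ _ _)) ⟨≈⟩ c⊙ (by (B1 tau)) rfl

    solution : ∀ {x} → ⦃ Ov x ⦄ → at tau ⊙ x ≈ rec E 0
    solution {x} = rsp E-Rec (λ _ → at tau ⊙ x) (λ { _ _ refl → sym′ τ-step })

  γ-prefix-nf : ∀ a b {x} → Process x → HasNf ((at a ∣ᶜ at b) ⊙ x)
  γ-prefix-nf a b {x} q = c⊙ (by (CF a b)) rfl ◃ go a refl
    where
    instance _ = Process⇒Over q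
    go : ∀ a {c} → γ a b ≡ c → HasNf (at c ⊙ x)
    go _       {act c} _ = nf (pre (act q))
    go _       {delta} _ = by (A7 _) ◃ δ-nf
    go (act a) {tau}   e = τ-collapse e ◃ nf (atom tau)
    go tau     {tau}   e with () ← trans (sym e) (γ-tau b)
    go delta   {tau}   e with () ← trans (sym e) (γ-delta b)

  -- These are the two shapes of a right operand for which `DCM1` and `DCM2` resolve a left merge
  -- with a delayed left operand.
  data Timing (t : Term n) : Set where
    now   : t ≈ ν t → Timing t
    later : ∀ {z} → Process z → t ≈ ν t ⊕ σ z → Timing t

  timing : ∀ {s} → Nf s → Timing s
  timing (atom a) = now (sym′ (by (NU1 a)))
  timing (pre x) = now (sym′ ν-prefix)
    where instance _ = Tail⇒Over x
  timing (σ x) = later x (sym′ (by (A6 _)) ⟨≈⟩ by (A1 _ _) ⟨≈⟩ c⊕ (sym′ (by (NU4 _))) rfl)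
    where instance _ = Process⇒Over x
  timing (p ⊕ q) with timing p | timing q
  ... | now d     | now e     = now (c⊕ d e ⟨≈⟩ sym′ (by (NU2 _ _)))
    where instance _ = Nf⇒Over p
                   _ = Nf⇒Over q
  ... | now d     | later z e =
    later z (c⊕ d e ⟨≈⟩ sym′ (by (A2 _ _ _)) ⟨≈⟩ c⊕ (sym′ (by (NU2 _ _))) rfl)
    where instance _ = Nf⇒Over p
                   _ = Nf⇒Over q
                   _ = Process⇒Over z
  ... | later z d | now e     =
    later z (c⊕ d e ⟨≈⟩ by (A2 _ _ _) ⟨≈⟩ c⊕ rfl (by (A1 _ _)) ⟨≈⟩ sym′ (by (A2 _ _ _))
             ⟨≈⟩ c⊕ (sym′ (by (NU2 _ _))) rfl)
    where instance _ = Nf⇒Over p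
                   _ = Nf⇒Over q
                   _ = Process⇒Over z
  ... | later z d | later w e =
    -- The four summands are regrouped so that the two delayed ones become adjacent and `DRT1` joins
    -- them.
    later (z ⊕ w) (c⊕ d e ⟨≈⟩ by (A2 _ _ _)
      ⟨≈⟩ c⊕ rfl (sym′ (by (A2 _ _ _)) ⟨≈⟩ c⊕ (by (A1 _ _)) rfl ⟨≈⟩ by (A2 _ _ _)
                   ⟨≈⟩ c⊕ rfl (by (DRT1 _ _)))
      ⟨≈⟩ sym′ (by (A2 _ _ _)) ⟨≈⟩ c⊕ (sym′ (by (NU2 _ _))) rfl)
    where instance _ = Nf⇒Over p
                   _ = Nf⇒Over q
                   _ = Process⇒Over z
                   _ = Process⇒Over w

  -- Against a delayed operand, an atom or prefix is first rewritten as its own time-out, by `NU1`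
  -- or `ν-prefix`, so that `DCM3` or `DCM4` applies.
  ∣-nf : ∀ {s t} → Nf s → Nf t → HasNf (s ∣ᶜ t)
  ∣-nf (p₁ ⊕ p₂) q = by (CM8 _ _ _) ◃ ⊕-nf (∣-nf p₁ q) (∣-nf p₂ q)
    where instance _ = Nf⇒Over p₁
                   _ = Nf⇒Over p₂
                   _ = Nf⇒Over q
  ∣-nf p@(atom _) (q₁ ⊕ q₂) = by (CM9 _ _ _) ◃ ⊕-nf (∣-nf p q₁) (∣-nf p q₂)
    where instance _ = Nf⇒Over q₁
                   _ = Nf⇒Over q₂
  ∣-nf p@(pre x) (q₁ ⊕ q₂) = by (CM9 _ _ _) ◃ ⊕-nf (∣-nf p q₁) (∣-nf p q₂)
    where instance _ = Tail⇒Over x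
                   _ = Nf⇒Over q₁
                   _ = Nf⇒Over q₂
  ∣-nf p@(σ x) (q₁ ⊕ q₂) = by (CM9 _ _ _) ◃ ⊕-nf (∣-nf p q₁) (∣-nf p q₂)
    where instance _ = Process⇒Over x
                   _ = Nf⇒Over q₁
                   _ = Nf⇒Over q₂
  ∣-nf (atom a) (atom b) = by (CF a b) ◃ nf (atom (γ a b))
  ∣-nf (atom a) (pre y) = by (CM6 _ _ _) ◃ γ-prefix-nf a _ (Tail⇒Process y)
    where instance _ = Tail⇒Over y
  ∣-nf (pre x) (atom b) = by (CM5 _ _ _) ◃ γ-prefix-nf _ b (Tail⇒Process x)
    where instance _ = Tail⇒Over x
  ∣-nf (pre x) (pre y) = by (CM7 _ _ _ _) ◃ γ-prefix-nf _ _ (Tail⇒Process x ‖ Tail⇒Process y)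
    where instance _ = Tail⇒Over x
                   _ = Tail⇒Over y
  ∣-nf (atom a) (σ y) = c∣ refl (sym′ (by (NU1 _))) rfl ⟨≈⟩ by (DCM3 _ _) ◃ δ-nf
    where instance _ = Process⇒Over y
  ∣-nf (pre x) (σ y) = c∣ refl (sym′ ν-prefix) rfl ⟨≈⟩ by (DCM3 _ _) ◃ δ-nf
    where instance _ = Tail⇒Over x
                   _ = Process⇒Over y
  ∣-nf (σ x) (atom b) = c∣ refl rfl (sym′ (by (NU1 _))) ⟨≈⟩ by (DCM4 _ _) ◃ δ-nf
    where instance _ = Process⇒Over x
  ∣-nf (σ x) (pre y) = c∣ refl rfl (sym′ ν-prefix) ⟨≈⟩ by (DCM4 _ _) ◃ δ-nf
    where instance _ = Process⇒Over x
                   _ = Tail⇒Over y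
  ∣-nf (σ x) (σ y) = by (DCM5 _ _) ◃ nf (σ (x ∣ᶜ y))
    where instance _ = Process⇒Over x
                   _ = Process⇒Over y

  mutual
    -- Only a τ-prefix leads from left merge back to merge, and it shortens one operand; hence the
    -- recursion terminates despite the swap in `CM1`. Behind guards the merge stays unevaluated.
    ‖-nf : ∀ {s t} → Nf s → Nf t → HasNf (s ‖ t)
    ‖-nf p q = by (CM1 _ _) ◃ ⊕-nf (⊕-nf (⌊⌊-nf p q) (⌊⌊-nf q p)) (∣-nf p q)
      where instance _ = Nf⇒Over p
                     _ = Nf⇒Over q

    ⌊⌊-nf : ∀ {s t} → Nf s → Nf t → HasNf (s ⌊⌊ t)
    ⌊⌊-nf p@(atom a) q = by (CM2 _ _) ◃ ⊙-nf p (Nf⇒Process q) (nf q)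
      where instance _ = Nf⇒Over q
    ⌊⌊-nf (pre (act x)) q = by (CM3 _ _ _) ◃ nf (pre (act (x ‖ Nf⇒Process q)))
      where instance _ = Process⇒Over x
                     _ = Nf⇒Over q
    ⌊⌊-nf (pre (tau p)) q = by (CM3 _ _ _) ◃ τ-nf (‖-nf p q)
      where instance _ = Nf⇒Over p
                     _ = Nf⇒Over q
    ⌊⌊-nf (p₁ ⊕ p₂) q = by (CM4 _ _ _) ◃ ⊕-nf (⌊⌊-nf p₁ q) (⌊⌊-nf p₂ q)
      where instance _ = Nf⇒Over p₁
                     _ = Nf⇒Over p₂
                     _ = Nf⇒Over q
    ⌊⌊-nf (σ x) q with timing q
    ... | now d = c⌊⌊ refl rfl d ⟨≈⟩ by (DCM1 _ _) ◃ δ-nf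
      where instance _ = Process⇒Over x
                     _ = Nf⇒Over q
    ... | later z d = c⌊⌊ refl rfl d ⟨≈⟩ by (DCM2 _ _ _) ◃ nf (σ (x ⌊⌊ z))
      where instance _ = Process⇒Over x
                     _ = Nf⇒Over q
                     _ = Process⇒Over z

  -- Normal forms of all processes

  Proc-nf : ∀ {P} → P ⊆ Rec → (∀ {E X} → P E X → HasNf (rec E X)) → ∀ {t} → Proc P t → HasNf t
  Proc-nf i r at = nf (atom _)
  Proc-nf i r (x ⊕ y) = ⊕-nf (Proc-nf i r x) (Proc-nf i r y)
  Proc-nf i r (x ⊙ y) =
    let _ , p , d = Proc-nf i r x
        q = Proc⇒Process i y
    in c⊙ d (refl′ (Process⇒Over q)) ◃ ⊙-nf p q (Proc-nf i r y)
  Proc-nf i r (act⊙ y) = nf (pre (act y))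
  Proc-nf i r (x ‖ y) =
    let _ , p , d = Proc-nf i r x ; _ , q , e = Proc-nf i r y in c‖ refl d e ◃ ‖-nf p q
  Proc-nf i r (x ⌊⌊ y) =
    let _ , p , d = Proc-nf i r x ; _ , q , e = Proc-nf i r y in c⌊⌊ refl d e ◃ ⌊⌊-nf p q
  Proc-nf i r (x ∣ᶜ y) =
    let _ , p , d = Proc-nf i r x ; _ , q , e = Proc-nf i r y in c∣ refl d e ◃ ∣-nf p q
  Proc-nf i r (σ x) = nf (σ x)
  Proc-nf i r (∂[ H ] x) = let _ , p , d = Proc-nf i r x in c∂ H refl d ◃ ∂-nf H p
  Proc-nf i r (ν x) = let _ , p , d = Proc-nf i r x in cν d ◃ ν-nf p
  Proc-nf i r (rec p) = r p

  -- Induction on the stratum: the guarded term reached from the right-hand side of `X` has only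
  -- constants of stratum `k` at unguarded positions. The constants put in for variables of `E` sit
  -- behind guards, where `Proc-nf` leaves them alone.
  rec-nf : ∀ k {E X} → RecOK γ acp k E X → HasNf (rec E X)
  rec-nf (suc k) (inj₁ p) = rec-nf k p
  rec-nf (suc k) {E} {X} (inj₂ ((t , e) , so , gm)) =
    let isRec     = λ Y d → suc k , inj₂ (d , so , gm)
        oₜ , vars = so X t e
        _ , r , g = gm X t e
        o , d     = Rw-sound k so isRec r oₜ
        closed    = close-elim Process E (λ Y d → rec (isRec Y d)) at
        unfold    = subst (rec E X ≈_) (sym (sub-cong (close-just E) vars)) (rdp (isRec X (t , e)) e)
    in unfold ⟨≈⟩ d ◃ Proc-nf (k ,_) (rec-nf k) (G⇒Proc (k ,_) closed g o)

  process-nf : ∀ {t} → Process t → HasNf t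
  process-nf = Proc-nf id (λ { (k , p) → rec-nf k p })

  -- The specification whose variables are the positions in the infinite
  -- unfolding of a normal form: 2[1+ x ] and 1+[2 x ] are the children of x.

  left right : ∃ Nf → ∃ Nf
  -- Behind a guard the child is a newly computed normal form; after τ or at a sum it is a part of
  -- the present one.
  left (_ , pre (act x)) = let s , p , _ = process-nf x in s , p
  left (_ , pre (tau p)) = _ , p
  left (_ , p ⊕ q)       = _ , p
  left (_ , σ x)         = let s , p , _ = process-nf x in s , p
  -- Where there is no child the node is repeated, so that every position carries an equation.
  left s@(_ , atom _)    = s
  right (_ , p ⊕ q)      = _ , q
  right s                = s

  -- Sums and τ-tails are expanded in place, so variables appear only behind an action of A or σ.
  -- The position descends in step with `left` and `right`.
  rhs : ∀ {s} → Nf s → ℕᵇ → Term n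
  rhs (atom a)              x = at a
  rhs (pre {a} (act _))     x = at a ⊙ v (toℕ 2[1+ x ])
  rhs (pre (tau p))         x = at tau ⊙ rhs p 2[1+ x ]
  rhs (p ⊕ q)               x = rhs p 2[1+ x ] ⊕ rhs q 1+[2 x ]
  rhs (σ _)                 x = σ (v (toℕ 2[1+ x ]))

  rhs-Over : ∀ {T P s} (p : Nf s) x → Over T P (rhs p x)
  rhs-Over (atom a)      x = at
  rhs-Over (pre (act _)) x = at ⊙ v
  rhs-Over (pre (tau p)) x = at ⊙ rhs-Over p _
  rhs-Over (p ⊕ q)       x = rhs-Over p _ ⊕ rhs-Over q _
  rhs-Over (σ _)         x = σ v

  rhs-AllVars : ∀ {Q : ℕ → Set} → (∀ Y → Q Y) → ∀ {s} (p : Nf s) x → AllVars Q (rhs p x)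
  rhs-AllVars h (atom a)      x = at
  rhs-AllVars h (pre (act _)) x = at ⊙ v (h _)
  rhs-AllVars h (pre (tau p)) x = at ⊙ rhs-AllVars h p _
  rhs-AllVars h (p ⊕ q)       x = rhs-AllVars h p _ ⊕ rhs-AllVars h q _
  rhs-AllVars h (σ _)         x = σ (v (h _))

  rhs-Guarded : ∀ {s} (p : Nf s) x → Guarded (rhs p x)
  rhs-Guarded (atom a)      x = at
  rhs-Guarded (pre (act _)) x = act⊙ v
  rhs-Guarded (pre (tau p)) x = at ⊙ rhs-Guarded p _
  rhs-Guarded (p ⊕ q)       x = rhs-Guarded p _ ⊕ rhs-Guarded q _
  rhs-Guarded (σ _)         x = σ v

  module Unfolding (root : ∃ Nf) where

    node : ℕᵇ → ∃ Nf
    node 0ᵇ       = root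
    node 2[1+ x ] = left (node x)
    node 1+[2 x ] = right (node x)

    spec : Spec n
    spec j = just (rhs (proj₂ (node (fromℕ j))) (fromℕ j))

    -- The right-hand sides contain no recursion constants and are guarded without rewriting, so the
    -- first stratum of either theory admits them.
    spec-RecC : ∀ T → RecC γ T spec 0
    spec-RecC T = 1 , inj₂ ((_ , refl) ,
      (λ { j _ refl → rhs-Over (proj₂ (node (fromℕ j))) _
                    , rhs-AllVars (λ _ → _ , refl) (proj₂ (node (fromℕ j))) _ }) ,
      (λ { j _ refl → _ , rrefl , rhs-Guarded (proj₂ (node (fromℕ j))) _ }))

    value : ℕ → Term n
    value j = proj₁ (node (fromℕ j))

    -- Positions are binary, for the recursion of `node`, while variables are named by natural
    -- numbers; the round trip identifies the two.
    value-toℕ : ∀ x {s} → node x ≡ s → proj₁ s ≡ value (toℕ x)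
    value-toℕ x refl = cong (proj₁ ∘ node) (sym (fromℕ-toℕ x))

    -- The hypothesis on `node x` ties the parts of `p` to the positions. Where the expansion stops
    -- at a guard, the variable stands for the normal form of the tail, to which the tail is
    -- derivably equal.
    value-solves : ∀ {s} (p : Nf s) x → node x ≡ (s , p) → s ≈ sub value (rhs p x)
    value-solves (atom a) x e = rfl
    value-solves (pre (act q)) x e =
      c⊙ rfl (subst (_ ≈_) (value-toℕ 2[1+ x ] (cong left e)) (proj₂ (proj₂ (process-nf q))))
    value-solves (pre (tau p)) x e = c⊙ rfl (value-solves p _ (cong left e))
    value-solves (p ⊕ q) x e = c⊕ (value-solves p _ (cong left e)) (value-solves q _ (cong right e))
    value-solves (σ q) x e =
      cσ (subst (_ ≈_) (value-toℕ 2[1+ x ] (cong left e)) (proj₂ (proj₂ (process-nf q))))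

    root≈rec : proj₁ root ≈ rec spec 0
    root≈rec = rsp (spec-RecC acp) value
      (λ { j _ refl → value-solves (proj₂ (node (fromℕ j))) (fromℕ j) refl })

theorem15 : (n : ℕ) (γ : Act n → Act n → Act n) →
    (∀ a b → γ a b ≡ γ b a) →
    (∀ a b c → γ a (γ b c) ≡ γ (γ a b) c) →
    (∀ a → γ tau a ≡ delta) →
    (∀ a → γ delta a ≡ delta) →
    (t : Term n) → Closed t → TermOf γ acp t → NoAbs t →
    Σ (Term n) (λ t′ →
    Closed t′ × TermOf γ acp t′ × TermOf γ bpa t′ × Derivable γ acp t t′)
theorem15 n γ _ _ γ-tau γ-delta t closed over noAbs =
  let open Normalisation γ γ-tau γ-delta
      s , p , t≈s = process-nf (NoAbs⇒Process closed over noAbs)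
      open Unfolding (s , p)
  -- The root is at position 0, hence variable 0. The second `rec spec 0` is the proof of
  -- closedness.
  in rec spec 0 , rec spec 0 , rec (spec-RecC acp) , rec (spec-RecC bpa) , trans′ t≈s root≈rec
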